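{- Any direct path matrix $L=\|l_{ij}\|_1^n$ (an $n\times n$ matrix with entries in $\{0,1\}$) can be transformed to the quasicanonical (quasinormal) form, of order $n+s_q$, by applying the $\Delta n$-transformation to such $s_q$ ($s_q\le n^2-1$) elements of the matrix $\|l_{ij}\|_1^n$ which do not satisfy the quasicanonicity conditions.
   Context: A direct path matrix is the $n\times n$ 0-1 matrix $L=(l_{ij})$ of a binary relation on a finite set $\{q_1,\dots,q_n\}$: $l_{ij}=1$ iff $q_i$ is related to $q_j$ (written $q_i<q_j$). The matrix $C(M)$: for a $k\times k$ 0-1 matrix $M=(m_{ij})$ put $s_{ij}=m_{ij}\left(\sum_{a=1}^k m_{aj}+\sum_{b=1}^k m_{ib}\right)$. If $m_{ij}=1$ put $c_{ij}=\left(s_{ij}-\min_b\{s_{ib}: s_{ib}\neq 0\}\right)+\left(s_{ij}-\min_a\{s_{aj}: s_{aj}\ne 0\}\right)$; if $m_{ij}=0$ put $c_{ij}=0$. Then $C(M)=(c_{ij})$. Quasicanonicity conditions for a 0-1 matrix $M$: (1) $C(M)=0$; (2) for every $(i,j)$ with $m_{ij}=1$, the matrix $M^{(i,j)}$ obtained by deleting row $i$ and column $j$ satisfies $C(M^{(i,j)})=0$. A matrix satisfying them is called quasicanonical (quasinormal). The elements $m_{ij}=1$ which do not satisfy these conditions are, in other words, those which generate $c_{ij}\neq 0$. The elements are found by repeated checks: all elements found in one check are subjected to the $\Delta n$-transformation, then the resulting matrix is checked again, and so on until no such elements are found. $\Delta n$-transformation of an element $m_{xy}=1$ of a $k\times k$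 0-1 matrix: one row and one column with index $k+1$ are added, the element $(x,y)$ is replaced by $0$, the elements $(x,k+1)$ and $(k+1,y)$ are set equal to $1$, the other elements of the new row and column are $0$, and all remaining elements are unchanged (the relation $q_x<q_y$ is replaced by the pair $q_x<q_{k+1}$, $q_{k+1}<q_y$). -}

module Defs where

open import Data.Bool.Base using (if_then_else_; _∧_)
open import Data.Fin.Base using (Fin; toℕ; inject₁; punchIn)
open import Data.Fin.Patterns using (0F; 1F)
open import Data.Fin.Properties using (_≟_)
open import Data.Fin.Relation.Unary.Top using (view; ‵fromℕ; ‵inject₁)
open import Data.List.Base using (List; []; _∷_; _++_; length; map; tabulate; filter)
open import Data.List.Extrema.Nat using (min)
open import Data.List.Membership.Propositional using (_∈_)
open import Data.List.Relation.Unary.Unique.Propositional using (Unique)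
open import Data.Nat.Base using (ℕ; zero; suc; pred; _+_; _*_; _∸_)
open import Data.Nat.ListAction using (sum)
import Data.Nat.Properties as ℕ
open import Data.Product.Base using (∃; _×_; _,_)
open import Data.Sum.Base using (_⊎_)
open import Function.Bundles using (_⇔_)
open import Relation.Binary.PropositionalEquality using (_≡_; _≢_)
open import Relation.Nullary using (¬?)
open import Relation.Nullary.Decidable using (does)

-- Square 0-1 matrices; 1F at (i , j) means q_i < q_j.
Matrix : ℕ → Set
Matrix k = Fin k → Fin k → Fin 2

S : ∀ {k} → Matrix k → Fin k → Fin k → ℕ
S M i j = toℕ (M i j) * (sum (tabulate λ a → toℕ (M a j)) + sum (tabulate λ b → toℕ (M i b)))

nonzeros : ∀ {k} → (Fin k → ℕ) → List ℕ
nonzeros f = filter (λ v → ¬? (v ℕ.≟ 0)) (tabulate f)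

-- The first argument of `min` is its value on the empty list.  When
-- M i j ≡ 1F, S M i j ≥ 2 itself occurs in both lists, so it does not affect
-- either minimum, and both truncated subtractions are exact.
C : ∀ {k} → Matrix k → Fin k → Fin k → ℕ
C M i j with M i j
... | 0F = 0
... | 1F = (s ∸ min s (nonzeros λ b → S M i b)) + (s ∸ min s (nonzeros λ a → S M a j))
  where s = S M i j

-- `skip a` enumerates the indices other than a in increasing order (`punchIn`
-- for an order not syntactically a successor).
skip : ∀ {k} → Fin k → Fin (pred k) → Fin k
skip {suc k} = punchIn

delete : ∀ {k} → Matrix k → Fin k → Fin k → Matrix (pred k)
delete M a b i j = M (skip a i) (skip b j)

Quasicanonical : ∀ {k} → Matrix k → Set
Quasicanonical M =
  (∀ i j → C M i j ≡ 0) ×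
  (∀ a b → M a b ≡ 1F → ∀ i j → C (delete M a b) i j ≡ 0)

-- A unit element violates the conditions when it produces a nonzero entry at
-- its own place, either in C M or in C of one of the matrices M^(a,b) in which
-- it survives.
Violating : ∀ {k} → Matrix k → Fin k × Fin k → Set
Violating M (x , y) = M x y ≡ 1F ×
  (C M x y ≢ 0 ⊎
   ∃ λ a → ∃ λ b → M a b ≡ 1F ×
   ∃ λ i → ∃ λ j → skip a i ≡ x × skip b j ≡ y × C (delete M a b) i j ≢ 0)

-- The added index is the last one, `fromℕ k`; old indices are embedded by
-- `inject₁`.
Δn : ∀ {k} → Matrix k → Fin k × Fin k → Matrix (suc k)
Δn M (x , y) i j with view i | view j
... | ‵inject₁ i′ | ‵inject₁ j′ = if does (i′ ≟ x) ∧ does (j′ ≟ y) then 0F else M i′ j′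
... | ‵inject₁ i′ | ‵fromℕ      = if does (i′ ≟ x) then 1F else 0F
... | ‵fromℕ      | ‵inject₁ j′ = if does (j′ ≟ y) then 1F else 0F
... | ‵fromℕ      | ‵fromℕ      = 0F

old : ∀ {n} s → Fin n → Fin (s + n)
old zero    i = i
old (suc s) i = inject₁ (old s i)

oldPair : ∀ {n} s → Fin n × Fin n → Fin (s + n) × Fin (s + n)
oldPair s (x , y) = old s x , old s y

-- Transform the listed elements of the original matrix, last one first.
Δn* : ∀ {n} → Matrix n → (es : List (Fin n × Fin n)) → Matrix (length es + n)
Δn* L []       = L
Δn* L (e ∷ es) = Δn (Δn* L es) (oldPair (length es) e)

FoundByCheck : ∀ {k} → Matrix k → List (Fin k × Fin k) → Set
FoundByCheck M es = Unique es × (∀ e → e ∈ es ⇔ Violating M e)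

-- `Checks L es`: es lists the elements transformed so far (latest first) in a
-- sequence of checks, each followed by the transformation of all the elements
-- it found.  As es consists of positions of L, a check can be carried out only
-- if no element introduced by a transformation is found in it.
data Checks {n} (L : Matrix n) : List (Fin n × Fin n) → Set where
  start : Checks L []
  check : ∀ {es} → Checks L es →
          ∀ fs → FoundByCheck (Δn* L es) (map (oldPair (length es)) fs) →
          Checks L (fs ++ es)

{-# OPTIONS --safe #-}

-- If every unit of row i and every unit of column j meet in a unit of M, then
-- the sums of column j and row i are minimal among those of the neighbours of
-- (i , j), so C M i j ≡ 0; the condition passes to M^(a,b).  The two elements
-- introduced by a Δn-transformation are alone in their column or row, hence
-- satisfy it, and stay alone under later transformations.  Therefore a check
-- only finds elements of L not transformed before, the checks terminate, and a
-- matrix in which nothing is found is quasicanonical.  If every entry of L is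
-- a unit nothing is found at all; otherwise at most n ^ 2 ∸ 1 positions of L
-- can ever be transformed.
module Submission where

open import Defs
open import Data.Fin.Base using (Fin; zero; suc; toℕ; fromℕ; inject₁; combine)
open import Data.Fin.Patterns using (0F; 1F)
open import Data.Fin.Properties using (_≟_; any?; all?; ¬∀⟶∃¬; inject₁-injective; combine-injective; injective⇒≤)
open import Data.Fin.Relation.Unary.Top using (view; view-fromℕ; view-inject₁; ‵fromℕ; ‵inject₁)
open import Data.List.Base using (List; []; _∷_; _++_; length; map; tabulate; filter; allFin; cartesianProduct; lookup)
open import Data.List.Extrema.Nat using (min; v≤min⁺)
open import Data.List.Membership.Propositional using (_∈_; _∉_)
open import Data.List.Membership.Propositional.Properties using (∈-filter⁺; ∈-filter⁻; ∈-map⁺; ∈-map⁻; ∈-cartesianProduct⁺; ∈-allFin; ∈-lookup)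
open import Data.List.Properties using (length-++)
open import Data.List.Relation.Unary.All as All using (All; []; _∷_)
import Data.List.Relation.Unary.All.Properties as All
open import Data.List.Relation.Unary.AllPairs using ([]; _∷_)
open import Data.List.Relation.Unary.Any using (here; there)
open import Data.List.Relation.Unary.Unique.Propositional using (Unique)
import Data.List.Relation.Unary.Unique.Propositional.Properties as Unique
open import Data.Nat.Base using (ℕ; zero; suc; NonZero; _+_; _*_; _≤_; _<_; _∸_; _^_; z≤n; s≤s)
open import Data.Nat.ListAction using (sum)
import Data.Nat.Properties as ℕ
open import Data.Product.Base using (Σ-syntax; ∃; _×_; _,_; proj₁; proj₂; uncurry)
open import Data.Product.Properties using (,-injective)
open import Data.Sum.Base as Sum using (_⊎_; inj₁; inj₂)
open import Function.Base using (_∘_)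
open import Function.Bundles using (mk⇔)
open import Relation.Binary.PropositionalEquality using (_≡_; _≢_; refl; sym; cong; cong₂; subst)
open import Relation.Nullary using (¬_; Dec; yes; no; ¬?; contradiction; _×-dec_; _⊎-dec_)
open import Relation.Nullary.Decidable using (decidable-stable)

-- Rectangular elements and violation.

Rectangular : ∀ {k} → Matrix k → Fin k → Fin k → Set
Rectangular M i j = ∀ a b → M i b ≡ 1F → M a j ≡ 1F → M a b ≡ 1F

toℕ-mono-unit : {p q : Fin 2} → (p ≡ 1F → q ≡ 1F) → toℕ p ≤ toℕ q
toℕ-mono-unit {0F}     _ = z≤n
toℕ-mono-unit {1F} {q} h = ℕ.≤-reflexive (cong toℕ (sym (h refl)))

sum-tabulate-mono : ∀ {k} (f g : Fin k → ℕ) → (∀ i → f i ≤ g i) →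
                    sum (tabulate f) ≤ sum (tabulate g)
sum-tabulate-mono {zero}  f g f≤g = z≤n
sum-tabulate-mono {suc k} f g f≤g =
  ℕ.+-mono-≤ (f≤g zero) (sum-tabulate-mono (f ∘ suc) (g ∘ suc) (f≤g ∘ suc))

S-mono : ∀ {k} (M : Matrix k) {i j i′ j′} → M i′ j′ ≡ 1F →
         (∀ a → M a j ≡ 1F → M a j′ ≡ 1F) → (∀ b → M i b ≡ 1F → M i′ b ≡ 1F) →
         S M i j ≤ S M i′ j′
S-mono M {i} {j} u cols rows = ℕ.*-mono-≤ (toℕ-mono-unit {M i j} λ _ → u)
  (ℕ.+-mono-≤ (sum-tabulate-mono _ _ λ a → toℕ-mono-unit (cols a))
              (sum-tabulate-mono _ _ λ b → toℕ-mono-unit (rows b)))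

S≢0⇒unit : ∀ {k} (M : Matrix k) i j → S M i j ≢ 0 → M i j ≡ 1F
S≢0⇒unit M i j s≢0 with M i j
... | 0F = contradiction refl s≢0
... | 1F = refl

-- The default of `min` is `s` itself, so the minimum is at least `s` even on an empty list, and
-- truncated subtraction gives 0.
∸min-nonzeros≡0 : ∀ {k} (f : Fin k → ℕ) {s} → (∀ i → f i ≢ 0 → s ≤ f i) →
                  s ∸ min s (nonzeros f) ≡ 0
∸min-nonzeros≡0 f {s} s≤f = ℕ.m≤n⇒m∸n≡0 (v≤min⁺ ℕ.≤-refl
  (All.zipWith (λ (v≢0 , s≤v) → s≤v v≢0)
    ( All.all-filter nonzero? (tabulate f)
    , All.filter⁺ nonzero? (All.tabulate⁺ {P = λ v → v ≢ 0 → s ≤ v} s≤f))))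
  where nonzero? = λ v → ¬? (v ℕ.≟ 0)

-- A unit `(i , b)` shares its row sum with `(i , j)`, and rectangularity sends every unit of column
-- `j` into column `b`, so `S M i j ≤ S M i b`; dually for the units of column `j`.
rectangular⇒C≡0 : ∀ {k} (M : Matrix k) i j → M i j ≡ 1F → Rectangular M i j → C M i j ≡ 0
rectangular⇒C≡0 M i j Mij rect with M i j in eq
... | 1F = cong₂ _+_
  (∸min-nonzeros≡0 _ λ b s≢0 → let Mib = S≢0⇒unit M i b s≢0 in
    S-mono M Mib (λ a → rect a b Mib) (λ _ u → u))
  (∸min-nonzeros≡0 _ λ a s≢0 → let Maj = S≢0⇒unit M a j s≢0 in
    S-mono M Maj (λ _ u → u) (λ b Mib → rect a b Mib Maj))

C≢0⇒unit : ∀ {k} (M : Matrix k) i j → C M i j ≢ 0 → M i j ≡ 1F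
C≢0⇒unit M i j c≢0 with M i j
... | 0F = contradiction refl c≢0
... | 1F = refl

rectangular⇒¬violating : ∀ {k} (M : Matrix k) x y → Rectangular M x y → ¬ Violating M (x , y)
rectangular⇒¬violating M x y rect (Mxy , inj₁ c≢0) = c≢0 (rectangular⇒C≡0 M x y Mxy rect)
rectangular⇒¬violating M x y rect (Mxy , inj₂ (a , b , _ , i , j , refl , refl , c≢0)) =
  -- The condition ranges over all rows and columns, so it restricts along `skip`.
  c≢0 (rectangular⇒C≡0 (delete M a b) i j Mxy λ p q → rect (skip a p) (skip b q))

-- A nonzero entry of `C` sits at a unit; for a deleted matrix, `skip` carries it back to a
-- violating element of `M`.
nonviolating⇒quasicanonical : ∀ {k} (M : Matrix k) → (∀ e → ¬ Violating M e) → Quasicanonical M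
nonviolating⇒quasicanonical M none =
  (λ i j → decidable-stable (C M i j ℕ.≟ 0) λ c≢0 →
    none (i , j) (C≢0⇒unit M i j c≢0 , inj₁ c≢0)) ,
  (λ a b Mab i j → decidable-stable (C (delete M a b) i j ℕ.≟ 0) λ c≢0 →
    none (skip a i , skip b j)
      ( C≢0⇒unit (delete M a b) i j c≢0
      , inj₂ (a , b , Mab , i , j , refl , refl , c≢0)))

violating? : ∀ {k} (M : Matrix k) e → Dec (Violating M e)
violating? M (x , y) = M x y ≟ 1F ×-dec
  (¬? (C M x y ℕ.≟ 0) ⊎-dec
   any? λ a → any? λ b → M a b ≟ 1F ×-dec
   any? λ i → any? λ j → skip a i ≟ x ×-dec skip b j ≟ y ×-dec ¬? (C (delete M a b) i j ℕ.≟ 0))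

-- The invariant to be tracked, since rectangularity is not stable: in the all-ones 2 × 2 matrix,
-- transforming one corner destroys it at the opposite corner.
Lone : ∀ {k} → Matrix k → Fin k → Fin k → Set
Lone M i j = (∀ a → M a j ≡ 1F → a ≡ i) ⊎ (∀ b → M i b ≡ 1F → b ≡ j)

lone⇒rectangular : ∀ {k} (M : Matrix k) i j → Lone M i j → Rectangular M i j
lone⇒rectangular M i j (inj₁ lone) a b Mib Maj with refl ← lone a Maj = Mib
lone⇒rectangular M i j (inj₂ lone) a b Mib Maj with refl ← lone b Mib = Maj

-- Units under one Δn-transformation.

Δn-unit⁻ : ∀ {k} (M : Matrix k) e i j → Δn M e (inject₁ i) (inject₁ j) ≡ 1F →
           (i , j) ≢ e × M i j ≡ 1F
Δn-unit⁻ M (x , y) i j u rewrite view-inject₁ i | view-inject₁ j with i ≟ x | j ≟ y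
... | no i≢x | _      = (λ { refl → i≢x refl }) , u
... | yes _  | no j≢y = (λ { refl → j≢y refl }) , u

Δn-unit⁺ : ∀ {k} (M : Matrix k) e i j → (i , j) ≢ e → M i j ≡ 1F →
           Δn M e (inject₁ i) (inject₁ j) ≡ 1F
Δn-unit⁺ M (x , y) i j ij≢e u rewrite view-inject₁ i | view-inject₁ j with i ≟ x | j ≟ y
... | no _     | _        = u
... | yes _    | no _     = u
... | yes refl | yes refl = contradiction refl ij≢e

Δn-newCol : ∀ {k} (M : Matrix k) e i → Δn M e (inject₁ i) (fromℕ k) ≡ 1F → i ≡ proj₁ e
Δn-newCol {k} M (x , y) i u rewrite view-inject₁ i | view-fromℕ k with i ≟ x
... | yes i≡x = i≡x

Δn-newRow : ∀ {k} (M : Matrix k) e j → Δn M e (fromℕ k) (inject₁ j) ≡ 1F → j ≡ proj₂ e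
Δn-newRow {k} M (x , y) j u rewrite view-inject₁ j | view-fromℕ k with j ≟ y
... | yes j≡y = j≡y

Δn-corner : ∀ {k} (M : Matrix k) e → Δn M e (fromℕ k) (fromℕ k) ≢ 1F
Δn-corner {k} M e u rewrite view-fromℕ k with () ← u

inject₁⊎fromℕ : ∀ {k} (i : Fin (suc k)) → (∃ λ j → i ≡ inject₁ j) ⊎ i ≡ fromℕ k
inject₁⊎fromℕ i with view i
... | ‵inject₁ j = inj₁ (j , refl)
... | ‵fromℕ     = inj₂ refl

-- A new unit enters column `j` only if `e` lies in that column; but `e` is a unit, so loneness
-- would force it to be `(i , j)`. Rows are symmetric.
Δn-lone : ∀ {k} (M : Matrix k) e i j → uncurry M e ≡ 1F → (i , j) ≢ e →
          Lone M i j → Lone (Δn M e) (inject₁ i) (inject₁ j)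
Δn-lone M e i j Me ij≢e (inj₁ lone) = inj₁ alone
  where
  alone : ∀ a → Δn M e a (inject₁ j) ≡ 1F → a ≡ inject₁ i
  alone a u with inject₁⊎fromℕ a
  ... | inj₁ (a′ , refl) = cong inject₁ (lone a′ (proj₂ (Δn-unit⁻ M e a′ j u)))
  ... | inj₂ refl with refl ← Δn-newRow M e j u =
    contradiction (cong (_, j) (sym (lone (proj₁ e) Me))) ij≢e
Δn-lone M e i j Me ij≢e (inj₂ lone) = inj₂ alone
  where
  alone : ∀ b → Δn M e (inject₁ i) b ≡ 1F → b ≡ inject₁ j
  alone b u with inject₁⊎fromℕ b
  ... | inj₁ (b′ , refl) = cong inject₁ (lone b′ (proj₂ (Δn-unit⁻ M e i b′ u)))
  ... | inj₂ refl with refl ← Δn-newCol M e i u =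
    contradiction (cong (i ,_) (sym (lone (proj₂ e) Me))) ij≢e

Δn-newCol-lone : ∀ {k} (M : Matrix k) e a →
                 Δn M e a (fromℕ k) ≡ 1F → a ≡ inject₁ (proj₁ e)
Δn-newCol-lone M e a u with inject₁⊎fromℕ a
... | inj₁ (a′ , refl) = cong inject₁ (Δn-newCol M e a′ u)
... | inj₂ refl        = contradiction u (Δn-corner M e)

Δn-newRow-lone : ∀ {k} (M : Matrix k) e b →
                 Δn M e (fromℕ k) b ≡ 1F → b ≡ inject₁ (proj₂ e)
Δn-newRow-lone M e b u with inject₁⊎fromℕ b
... | inj₁ (b′ , refl) = cong inject₁ (Δn-newRow M e b′ u)
... | inj₂ refl        = contradiction u (Δn-corner M e)

-- Repeated transformations and checks.

old-injective : ∀ {n} s {i j : Fin n} → old s i ≡ old s j → i ≡ j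
old-injective zero    eq = eq
old-injective (suc s) eq = old-injective s (inject₁-injective eq)

oldPair-injective : ∀ {n} s {e f : Fin n × Fin n} → oldPair s e ≡ oldPair s f → e ≡ f
oldPair-injective s eq with p , q ← ,-injective eq =
  cong₂ _,_ (old-injective s p) (old-injective s q)

module _ {n} (L : Matrix n) where

  Unit : Fin n × Fin n → Set
  Unit e = L (proj₁ e) (proj₂ e) ≡ 1F

  -- A transformation changes old entries only by clearing its own element, so nothing cleared is
  -- ever restored. This keeps checks from finding an element twice.
  Δn*-unit⁻ : ∀ es e → uncurry (Δn* L es) (oldPair (length es) e) ≡ 1F → e ∉ es × Unit e
  Δn*-unit⁻ []       e u = (λ ()) , u
  Δn*-unit⁻ (f ∷ es) e u
    with e≢f , u′ ← Δn-unit⁻ (Δn* L es) (oldPair (length es) f) _ _ u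
    with e∉es , Le ← Δn*-unit⁻ es e u′ =
    (λ { (here refl) → e≢f refl ; (there e∈es) → e∉es e∈es }) , Le

  Δn*-unit⁺ : ∀ es e → e ∉ es → Unit e → uncurry (Δn* L es) (oldPair (length es) e) ≡ 1F
  Δn*-unit⁺ []       e _      Le = Le
  Δn*-unit⁺ (f ∷ es) e e∉f∷es Le =
    Δn-unit⁺ (Δn* L es) (oldPair (length es) f) _ _
      (e∉f∷es ∘ here ∘ oldPair-injective (length es))
      (Δn*-unit⁺ es e (e∉f∷es ∘ there) Le)

  -- Units introduced by the latest transformation are alone in the new column or row; those
  -- introduced earlier stay lone by `Δn-lone`.
  Δn*-unit-origin : ∀ es → Unique es → All Unit es → ∀ p q → Δn* L es p q ≡ 1F →
                    Lone (Δn* L es) p q ⊎ ∃ λ e → (p , q) ≡ oldPair (length es) e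
  Δn*-unit-origin []       _   _          p q u = inj₂ ((p , q) , refl)
  Δn*-unit-origin (f ∷ es) uniq@(_ ∷ uniq′) (Lf ∷ Les) p q u with inject₁⊎fromℕ p | inject₁⊎fromℕ q
  ... | inj₁ (p′ , refl) | inj₁ (q′ , refl) with pq≢f , u′ ← Δn-unit⁻ (Δn* L es) _ p′ q′ u =
    Sum.map
      (Δn-lone (Δn* L es) _ p′ q′
        -- `f` is still a unit when its turn comes: being absent from `es`, it was not transformed
        -- before.
        (Δn*-unit⁺ es f (Unique.Unique[x∷xs]⇒x∉xs uniq) Lf) pq≢f)
      (λ { (e , refl) → e , refl })
      (Δn*-unit-origin es uniq′ Les p′ q′ u′)
  ... | inj₁ (p′ , refl) | inj₂ refl with refl ← Δn-newCol (Δn* L es) _ p′ u =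
    inj₁ (inj₁ (Δn-newCol-lone (Δn* L es) _))
  ... | inj₂ refl | inj₁ (q′ , refl) with refl ← Δn-newRow (Δn* L es) _ q′ u =
    inj₁ (inj₂ (Δn-newRow-lone (Δn* L es) _))
  ... | inj₂ refl | inj₂ refl = contradiction u (Δn-corner (Δn* L es) _)

  -- Justifies searching only the positions of `L` in each check.
  violating⇒old : ∀ es → Unique es → All Unit es → ∀ e → Violating (Δn* L es) e →
                  ∃ λ f → e ≡ oldPair (length es) f
  violating⇒old es uniq Les (p , q) v with Δn*-unit-origin es uniq Les p q (proj₁ v)
  ... | inj₁ lone = contradiction v
    (rectangular⇒¬violating (Δn* L es) p q (lone⇒rectangular (Δn* L es) p q lone))
  ... | inj₂ f    = f

  positions : List (Fin n × Fin n)
  positions = cartesianProduct (allFin n) (allFin n)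

  module _ (es : List (Fin n × Fin n)) where

    found? : ∀ e → Dec (Violating (Δn* L es) (oldPair (length es) e))
    found? e = violating? (Δn* L es) (oldPair (length es) e)

    found : List (Fin n × Fin n)
    found = filter found? positions

    found-unique : Unique found
    found-unique = Unique.filter⁺ found?
      (Unique.cartesianProduct⁺ (Unique.allFin⁺ n) (Unique.allFin⁺ n))

    ∈-found⁺ : ∀ e → Violating (Δn* L es) (oldPair (length es) e) → e ∈ found
    ∈-found⁺ e = ∈-filter⁺ found? (∈-cartesianProduct⁺ (∈-allFin _) (∈-allFin _))

    ∈-found⁻ : ∀ {e} → e ∈ found → Violating (Δn* L es) (oldPair (length es) e)
    ∈-found⁻ e∈found = proj₂ (∈-filter⁻ found? {xs = positions} e∈found)

    found-fresh : ∀ {e} → e ∈ found → e ∉ es × Unit e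
    found-fresh e∈found = Δn*-unit⁻ es _ (proj₁ (∈-found⁻ e∈found))

    found-foundByCheck : Unique es → All Unit es →
                         FoundByCheck (Δn* L es) (map (oldPair (length es)) found)
    found-foundByCheck uniq Les =
      Unique.map⁺ (oldPair-injective (length es)) found-unique ,
      λ e → mk⇔ to (from e)
      where
      to : ∀ {e} → e ∈ map (oldPair (length es)) found → Violating (Δn* L es) e
      to e∈ with f , f∈found , refl ← ∈-map⁻ (oldPair (length es)) e∈ = ∈-found⁻ f∈found
      from : ∀ e → Violating (Δn* L es) e → e ∈ map (oldPair (length es)) found
      from e v with f , refl ← violating⇒old es uniq Les e v =
        ∈-map⁺ (oldPair (length es)) (∈-found⁺ f v)

    found-empty⇒quasicanonical : Unique es → All Unit es → found ≡ [] → Quasicanonical (Δn* L es)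
    found-empty⇒quasicanonical uniq Les empty =
      nonviolating⇒quasicanonical (Δn* L es) λ e v → none e v (violating⇒old es uniq Les e v)
      where
      none : ∀ e → Violating (Δn* L es) e → ¬ (∃ λ f → e ≡ oldPair (length es) f)
      none e v (f , refl) with () ← subst (f ∈_) empty (∈-found⁺ f v)

-- Termination and the bound.

lookup-injective : ∀ {A : Set} {xs : List A} → Unique xs →
                   ∀ {i j} → lookup xs i ≡ lookup xs j → i ≡ j
lookup-injective (_ ∷ _)    {zero}  {zero}  _  = refl
lookup-injective (x∉ ∷ _)   {zero}  {suc j} eq = contradiction eq (All.lookup x∉ (∈-lookup j))
lookup-injective (x∉ ∷ _)   {suc i} {zero}  eq = contradiction (sym eq) (All.lookup x∉ (∈-lookup i))
lookup-injective (_ ∷ uniq) {suc i} {suc j} eq = cong suc (lookup-injective uniq eq)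

-- `lookup` followed by `combine` embeds the indices of the list into `Fin (n * n)`.
unique⇒length≤ : ∀ {n} {es : List (Fin n × Fin n)} → Unique es → length es ≤ n * n
unique⇒length≤ {n} {es} uniq = injective⇒≤ {f = uncurry combine ∘ lookup es} λ {i} {j} eq →
  lookup-injective uniq
    (uncurry (cong₂ _,_) (combine-injective (proj₁ (lookup es i)) _ (proj₁ (lookup es j)) _ eq))

module _ {n} (L : Matrix n) where

  Outcome : Set
  Outcome = Σ[ es ∈ List (Fin n × Fin n) ]
    (Unique es × All (Unit L) es × Checks L es × Quasicanonical (Δn* L es))

  -- A check that finds something lengthens `es` by at least one while `fuel` drops by one, so the
  -- bound persists; at zero fuel `es` would be too long to be free of repetitions.
  runChecks : ∀ fuel es → Unique es → All (Unit L) es → Checks L es →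
              n * n < length es + fuel → Outcome
  runChecks zero es uniq _ _ bound =
    contradiction (ℕ.<-≤-trans bound (ℕ.≤-reflexive (ℕ.+-identityʳ _))) (ℕ.≤⇒≯ (unique⇒length≤ uniq))
  runChecks (suc fuel) es uniq Les checks bound with found L es in eq
  ... | []     = es , uniq , Les , checks , found-empty⇒quasicanonical L es uniq Les eq
  ... | f ∷ fs = runChecks fuel (f ∷ fs ++ es)
    (Unique.++⁺ (subst Unique eq (found-unique L es)) uniq
      λ (e∈fs , e∈es) → proj₁ (fresh e∈fs) e∈es)
    (All.++⁺ (All.tabulate (proj₂ ∘ fresh)) Les)
    (check checks (f ∷ fs)
      (subst (FoundByCheck (Δn* L es) ∘ map (oldPair (length es))) eq
        (found-foundByCheck L es uniq Les)))
    (ℕ.≤-trans bound (ℕ.≤-trans (ℕ.≤-reflexive (ℕ.+-suc (length es) fuel))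
      (s≤s (ℕ.+-monoˡ-≤ fuel (ℕ.≤-trans (ℕ.m≤n+m _ (length fs))
        (ℕ.≤-reflexive (sym (length-++ fs))))))))
    where
    fresh : ∀ {e} → e ∈ f ∷ fs → e ∉ es × Unit L e
    fresh = found-fresh L es ∘ subst (_ ∈_) (sym eq)

theorem2 : ∀ (n : ℕ) .{{_ : NonZero n}} (L : Matrix n) →
    Σ[ es ∈ List (Fin n × Fin n) ]
      (Unique es ×
       All (λ e → L (proj₁ e) (proj₂ e) ≡ 1F) es ×
       Checks L es ×
       length es ≤ n ^ 2 ∸ 1 ×
       Quasicanonical (Δn* L es))
theorem2 n L with all? (λ i → all? (λ j → L i j ≟ 1F))
-- Treated apart: here no non-unit is available to save a position in the count.
... | yes full = [] , [] , [] , start , z≤n ,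
  nonviolating⇒quasicanonical L λ (x , y) →
    rectangular⇒¬violating L x y λ a b _ _ → full a b
... | no ¬full
  with i , ¬row ← ¬∀⟶∃¬ n _ (λ i → all? (λ j → L i j ≟ 1F)) ¬full
  with j , Lij≢1 ← ¬∀⟶∃¬ n _ (λ j → L i j ≟ 1F) ¬row
  -- With `es` empty, `suc (n * n)` is the least fuel meeting the strict bound.
  with es , uniq , Les , checks , quasi ← runChecks L (suc (n * n)) [] [] [] start ℕ.≤-refl =
  es , uniq , Les , checks , bound , quasi
  where
  bound : length es ≤ n ^ 2 ∸ 1
  bound = ℕ.≤-trans
    -- The non-unit `(i , j)` can be prepended to `es` without repetition; this gains the 1.
    (ℕ.∸-monoˡ-≤ 1 (unique⇒length≤
      (All.map (λ { Le refl → Lij≢1 Le }) Les ∷ uniq)))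
    -- `n ^ 2` unfolds to `n * (n * 1)`.
    (ℕ.≤-reflexive (cong (λ m → n * m ∸ 1) (sym (ℕ.*-identityʳ n))))
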